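{- Every strong semicomplete composition $Q=T[H_1,\dots,H_t]$ with at least four vertices has two distinct vertices $v_1,v_2$ such that $Q-v_i$ is strong for each $i\in\{1,2\}$.
   Context: Digraphs are finite, without loops or parallel arcs (2-cycles are allowed). A digraph is semicomplete if there is at least one arc between every pair of distinct vertices. Let $T$ be a digraph with vertices $u_1,\dots,u_t$ ($t\ge 2$) and let $H_1,\dots,H_t$ be pairwise disjoint nonempty digraphs, where $H_i$ has $n_i$ vertices. The composition $Q=T[H_1,\dots,H_t]$ is the digraph with vertex set $\bigcup_i V(H_i)$ and arc set $\bigcup_{i=1}^t A(H_i)\cup\{xy : x\in V(H_i),\ y\in V(H_p),\ u_iu_p\in A(T)\}$. It is a semicomplete composition if $T$ is semicomplete. A digraph is strong if for every ordered pair of vertices $(x,y)$ there is a directed path from $x$ to $y$. -}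

module Defs where

open import Level using (0ℓ)
open import Data.Nat using (ℕ)
open import Data.Fin using (Fin)
open import Data.Fin.Properties using (_≟_)
open import Data.List using (List; []; _∷_)
open import Data.List.Relation.Unary.Unique.Propositional using (Unique)
open import Data.Product using (Σ; _,_)
open import Data.Sum using (_⊎_)
open import Function using (_∘_)
open import Relation.Binary using (Rel; Decidable; Irreflexive)
open import Relation.Binary.Construct.Closure.ReflexiveTransitive using (Star; ε; _◅_)
open import Relation.Binary.PropositionalEquality using (_≡_; _≢_; refl)
open import Relation.Nullary using (yes; no)

-- Arcs form a relation, so there is no arc multiplicity: proofs of Arc x y are
-- never compared.  Finiteness is imposed through V: below, V is Fin n, a finite
-- sum of such types, or such a sum with one vertex removed.
record Digraph (V : Set) : Set₁ where
  field
    Arc      : Rel V 0ℓ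
    arc?     : Decidable Arc
    loopless : Irreflexive _≡_ Arc

open Digraph public

Semicomplete : {V : Set} → Digraph V → Set
Semicomplete {V} D = (x y : V) → x ≢ y → Arc D x y ⊎ Arc D y x

Walk : {V : Set} (D : Digraph V) → V → V → Set
Walk D = Star (Arc D)

walkVertices : {V : Set} (D : Digraph V) {x y : V} → Walk D x y → List V
walkVertices D {x} ε       = x ∷ []
walkVertices D {x} (_ ◅ w) = x ∷ walkVertices D w

Path : {V : Set} (D : Digraph V) → V → V → Set
Path D x y = Σ (Walk D x y) λ w → Unique (walkVertices D w)

Strong : {V : Set} → Digraph V → Set
Strong {V} D = (x y : V) → Path D x y

-- The inequality is irrelevant so that equality of remaining vertices is
-- equality in V.
record Remaining (V : Set) (v : V) : Set where
  constructor remaining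
  field
    vertex    : V
    .distinct : vertex ≢ v

open Remaining public

infixl 6 _-ᵛ_

_-ᵛ_ : {V : Set} → Digraph V → (v : V) → Digraph (Remaining V v)
(D -ᵛ v) .Arc x y           = Arc D (vertex x) (vertex y)
(D -ᵛ v) .arc? x y          = arc? D (vertex x) (vertex y)
(D -ᵛ v) .loopless refl x→x = loopless D refl x→x

-- The tag i makes the vertex sets of the Hᵢ pairwise disjoint.
CompositionVertex : {t : ℕ} → (Fin t → ℕ) → Set
CompositionVertex {t} n = Σ (Fin t) (Fin ∘ n)

data CompositionArc {t : ℕ} {n : Fin t → ℕ} (T : Digraph (Fin t))
                    (H : (i : Fin t) → Digraph (Fin (n i))) :
                    Rel (CompositionVertex n) 0ℓ where
  within  : ∀ {i} {x y : Fin (n i)} → Arc (H i) x y →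
            CompositionArc T H (i , x) (i , y)
  between : ∀ {i p} {x : Fin (n i)} {y : Fin (n p)} → Arc T i p →
            CompositionArc T H (i , x) (p , y)

composition : {t : ℕ} {n : Fin t → ℕ} (T : Digraph (Fin t)) →
              ((i : Fin t) → Digraph (Fin (n i))) → Digraph (CompositionVertex n)
composition T H .Arc = CompositionArc T H
composition T H .arc? (i , x) (p , y) with arc? T i p
... | yes i→p = yes (between i→p)
... | no  i↛p with i ≟ p
...   | no i≢p = no λ { (within _) → i≢p refl ; (between i→p) → i↛p i→p }
...   | yes refl with arc? (H i) x y
...     | yes x→y = yes (within x→y)
...     | no  x↛y = no λ { (within x→y) → x↛y x→y ; (between i→i) → i↛p i→i }
composition T H .loopless refl (within x→x)  = loopless (H _) refl x→x
composition T H .loopless refl (between i→i) = loopless T refl i→i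

{-# OPTIONS --safe #-}

-- Since t ≥ 2, strength of Q passes to T.  If some Hᵢ has two vertices, deleting
-- either keeps every part nonempty, and such a composition of the strong T is
-- strong.  Otherwise Q is T itself with t ≥ 4, and it suffices to find, for every
-- vertex v, some w ≢ v with T - w strong: apply this to any v, then to the w found.
-- To find w, grow a strong vertex set S ∋ v.  A vertex outside S with arcs both
-- from S and to S can be added.  If there is none, T has an arc b → a outside S
-- with all arcs from S to b and from a to S; then, for s ∈ S distinct from v,
-- (S ∖ s) ∪ {a , b} is strong and has exactly one vertex more than S, so the
-- growth cannot jump over the size t − 1.
module Submission where

open import Defs
open import Data.Nat using (ℕ; zero; suc; _≤_; _<_; z≤n; s≤s; _≤?_)
open import Data.Nat.Induction using (<-wellFounded)
open import Data.Nat.ListAction using (sum)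
open import Data.Nat.Properties using (≤-trans; +-mono-≤; ≰⇒>; ≤-pred)
open import Data.Empty using (⊥-elim-irr)
open import Data.Fin using (Fin; zero; suc; fromℕ<)
open import Data.Fin.Properties using (_≟_; any?; ¬∀⟶∃¬; pigeonhole; <-irrefl)
open import Data.List using (List; []; _∷_; tabulate; length; filter; allFin; lookup)
open import Data.List.Membership.Propositional using (_∈_; _∉_)
open import Data.List.Membership.Propositional.Properties using (∈-filter⁺; ∈-filter⁻; ∈-allFin)
import Data.List.Membership.DecPropositional as DecMembership
open import Data.List.Properties using (filter-notAll)
open import Data.List.Relation.Unary.All using ([])
open import Data.List.Relation.Unary.All.Properties using (¬Any⇒All¬)
open import Data.List.Relation.Unary.AllPairs using ([]; _∷_)
open import Data.List.Relation.Unary.Any using (here; there; index)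
import Data.List.Relation.Unary.Any as Any
open import Data.List.Relation.Unary.Any.Properties using (lookup-index)
open import Data.List.Relation.Unary.Unique.Propositional using (Unique)
open import Data.Product using (Σ; _×_; ∃; ∃₂; _,_; proj₁; proj₂)
open import Data.Product.Properties using (≡-dec)
open import Data.Sum using (_⊎_; inj₁; inj₂)
open import Function using (_∘_)
open import Induction.WellFounded using (Acc; acc)
open import Level using (0ℓ)
open import Relation.Binary using (Rel; DecidableEquality)
open import Relation.Binary.Construct.Closure.ReflexiveTransitive using (Star; ε; _◅_; _◅◅_; gmap; return)
open import Relation.Binary.PropositionalEquality using (_≡_; _≢_; refl; sym; trans; cong; subst; ≢-sym)
open import Relation.Nullary using (¬_; yes; no; ¬?; contradiction)
open import Relation.Nullary.Decidable using (_×-dec_; map′; decidable-stable)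
open import Relation.Unary using (Pred) renaming (Decidable to Decidable₁)

-- Walks and paths

Connected : {V : Set} → Digraph V → Set
Connected {V} D = (x y : V) → Walk D x y

module _ {V : Set} (_≟ⱽ_ : DecidableEquality V) (D : Digraph V) where

  open DecMembership _≟ⱽ_ using (_∈?_)

  pathFrom : ∀ {x y z} (w : Walk D x y) → Unique (walkVertices D w) →
             z ∈ walkVertices D w → Path D z y
  pathFrom ε       u       (here refl) = ε , u
  pathFrom (a ◅ w) u       (here refl) = a ◅ w , u
  pathFrom (a ◅ w) (_ ∷ u) (there z∈w) = pathFrom w u z∈w

  -- Loop erasure: if `x` recurs on the path obtained from the tail, the part of that path starting
  -- at `x` replaces the whole.
  walk⇒path : ∀ {x y} → Walk D x y → Path D x y
  walk⇒path ε = ε , [] ∷ []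
  walk⇒path {x} (a ◅ w) with walk⇒path w
  ... | p , u with x ∈? walkVertices D p
  ...   | yes x∈p = pathFrom p u x∈p
  ...   | no  x∉p = a ◅ p , ¬Any⇒All¬ _ x∉p ∷ u

  connected⇒strong : Connected D → Strong D
  connected⇒strong c x y = walk⇒path (c x y)

≟-remaining : {V : Set} {v : V} → DecidableEquality V → DecidableEquality (Remaining V v)
≟-remaining _≟ⱽ_ (remaining x _) (remaining y _) =
  map′ (λ { refl → refl }) (cong vertex) (x ≟ⱽ y)

crossing : {V : Set} {R : Rel V 0ℓ} {P : Pred V 0ℓ} → Decidable₁ P →
           ∀ {x y} → Star R x y → P x → ¬ P y →
           ∃₂ λ u w → R u w × P u × ¬ P w
crossing P? ε px ¬py = contradiction px ¬py
crossing P? (_◅_ {j = z} a w) px ¬py with P? z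
... | yes pz = crossing P? w pz ¬py
... | no ¬pz = _ , z , a , px , ¬pz

-- Noncritical vertices of semicomplete digraphs

-- Otherwise positions in `xs` would inject `Fin t` into a smaller set.
fresh : ∀ {t} (xs : List (Fin t)) → length xs < t → ∃ λ w → w ∉ xs
fresh {t} xs short = ¬∀⟶∃¬ t (_∈ xs) (_∈? xs) covered
  where
  open DecMembership _≟_ using (_∈?_)
  covered : ¬ (∀ i → i ∈ xs)
  covered i∈ with pigeonhole short (index ∘ i∈)
  ... | i , j , i<j , eq = <-irrefl i≡j i<j
    where
    i≡j : i ≡ j
    i≡j = trans (lookup-index (i∈ i))
            (trans (cong (lookup xs) eq) (sym (lookup-index (i∈ j))))

infixl 6 _∖_

_∖_ : ∀ {t} → List (Fin t) → Fin t → List (Fin t)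
L ∖ x = filter (λ z → ¬? (z ≟ x)) L

module _ {t : ℕ} where

  open DecMembership (_≟_ {t}) using (_∈?_)

  ∈-∖⁺ : ∀ {L : List (Fin t)} {x z} → z ∈ L → z ≢ x → z ∈ L ∖ x
  ∈-∖⁺ = ∈-filter⁺ _

  ∈-∖⁻ : ∀ (L : List (Fin t)) {x z} → z ∈ L ∖ x → z ∈ L × z ≢ x
  ∈-∖⁻ L = ∈-filter⁻ _ {xs = L}

  ∉-∖-self : ∀ (L : List (Fin t)) {x} → x ∉ L ∖ x
  ∉-∖-self L x∈ = proj₂ (∈-∖⁻ L x∈) refl

  ∉-∖-mono : ∀ (L : List (Fin t)) {x z} → z ∉ L → z ∉ L ∖ x
  ∉-∖-mono L z∉ z∈ = z∉ (proj₁ (∈-∖⁻ L z∈))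

  ∉-∖⁻ : ∀ (L : List (Fin t)) x {z} → z ∉ L ∖ x → z ≡ x ⊎ z ∉ L
  ∉-∖⁻ L x {z} z∉ with z ≟ x
  ... | yes z≡x = inj₁ z≡x
  ... | no  z≢x = inj₂ λ z∈L → z∉ (∈-∖⁺ z∈L z≢x)

  length-∖ : ∀ {L : List (Fin t)} {x} → x ∈ L → length (L ∖ x) < length L
  length-∖ {L} x∈L = filter-notAll _ L (Any.map (λ x≡y y≢x → y≢x (sym x≡y)) x∈L)

  module _ (D : Digraph (Fin t)) (semicomplete : Semicomplete D) (connected : Connected D) where

    infix 4 _⟶_

    _⟶_ : Rel (Fin t) 0ℓ
    _⟶_ = Arc D

    -- The growing set S is represented by a list L of the vertices outside it.
    ArcOff : List (Fin t) → Rel (Fin t) 0ℓ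
    ArcOff L x y = x ⟶ y × x ∉ L × y ∉ L

    ConnectedOff : List (Fin t) → Set
    ConnectedOff L = ∀ {x y} → x ∉ L → y ∉ L → Star (ArcOff L) x y

    throughHub : ∀ {L} h → (∀ {z} → z ∉ L → Star (ArcOff L) z h × Star (ArcOff L) h z) →
                 ConnectedOff L
    throughHub h hub x∉ y∉ = proj₁ (hub x∉) ◅◅ proj₂ (hub y∉)

    Insertable : List (Fin t) → Fin t → Set
    Insertable L x = x ∈ L × (∃ λ p → p ∉ L × p ⟶ x) × (∃ λ q → q ∉ L × x ⟶ q)

    insertable? : ∀ L → Decidable₁ (Insertable L)
    insertable? L x = (x ∈? L)
      ×-dec any? (λ p → ¬? (p ∈? L) ×-dec arc? D p x)
      ×-dec any? (λ q → ¬? (q ∈? L) ×-dec arc? D x q)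

    record Detour (L : List (Fin t)) : Set where
      field
        a b  : Fin t
        a∈L  : a ∈ L
        b∈L  : b ∈ L
        b⟶a  : b ⟶ a
        into : ∀ {s} → s ∉ L → s ⟶ b
        from : ∀ {s} → s ∉ L → a ⟶ s

      b≢a : b ≢ a
      b≢a b≡a = loopless D b≡a b⟶a

    ∈∉⇒≢ : ∀ {L : List (Fin t)} {x y} → x ∈ L → y ∉ L → x ≢ y
    ∈∉⇒≢ x∈ y∉ refl = y∉ x∈

    -- If nothing is insertable, a vertex of `L` with an arc from S has none to S, so by
    -- semicompleteness all of S has arcs to it; dually for a vertex of `L` with an arc to S.
    -- Connectedness yields an arc from a vertex of the first kind to one of the second.
    insertable⊎detour : ∀ L {v w} → v ∉ L → w ∈ L → ∃ (Insertable L) ⊎ Detour L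
    insertable⊎detour L {v} {w} v∉L w∈L with any? (insertable? L)
    ... | yes ins = inj₁ ins
    ... | no ¬ins = inj₂ detour
      where
      uninsertable : ∀ {x p q} → x ∈ L → p ∉ L → p ⟶ x → q ∉ L → ¬ x ⟶ q
      uninsertable x∈ p∉ p⟶x q∉ x⟶q = ¬ins (_ , x∈ , (_ , p∉ , p⟶x) , (_ , q∉ , x⟶q))

      detour : Detour L
      detour with crossing (λ z → ¬? (z ∈? L)) (connected v w) v∉L (λ w∉L → w∉L w∈L)
      ... | s , c , s⟶c , s∉L , ¬c∉L
          with decidable-stable (c ∈? L) ¬c∉L
      ... | c∈L
          -- On the way from `c` back to `v`, the property of lying in `L` without an arc to `v` is
          -- lost along some arc `b ⟶ a`.
          with crossing (λ z → (z ∈? L) ×-dec ¬? (arc? D z v)) (connected c v)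
                 (c∈L , uninsertable c∈L s∉L s⟶c v∉L) (λ (v∈L , _) → v∉L v∈L)
      ... | b , a , b⟶a , (b∈L , b↛v) , ¬Pa = record
        { a = a ; b = b ; a∈L = a∈L ; b∈L = b∈L ; b⟶a = b⟶a ; into = into ; from = from }
        where
        v⟶b : v ⟶ b
        v⟶b with semicomplete v b (≢-sym (∈∉⇒≢ b∈L v∉L))
        ... | inj₁ v⟶b = v⟶b
        ... | inj₂ b⟶v = contradiction b⟶v b↛v

        a∈L : a ∈ L
        -- If `a` were in S, then `v ⟶ b ⟶ a` would make `b` insertable.
        a∈L = decidable-stable (a ∈? L) λ a∉L → uninsertable b∈L v∉L v⟶b a∉L b⟶a

        a⟶v : a ⟶ v
        a⟶v = decidable-stable (arc? D a v) λ a↛v → ¬Pa (a∈L , a↛v)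

        into : ∀ {s} → s ∉ L → s ⟶ b
        into {s} s∉L with semicomplete s b (≢-sym (∈∉⇒≢ b∈L s∉L))
        ... | inj₁ s⟶b = s⟶b
        ... | inj₂ b⟶s = contradiction b⟶s (uninsertable b∈L v∉L v⟶b s∉L)

        from : ∀ {s} → s ∉ L → a ⟶ s
        from {s} s∉L with semicomplete a s (∈∉⇒≢ a∈L s∉L)
        ... | inj₁ a⟶s = a⟶s
        ... | inj₂ s⟶a = contradiction a⟶v (uninsertable a∈L s∉L s⟶a v∉L)

    insert-connected : ∀ {L x} → ConnectedOff L → Insertable L x → ConnectedOff (L ∖ x)
    insert-connected {L} {x} conn (_ , (p , p∉L , p⟶x) , (q , q∉L , x⟶q)) = throughHub x hub
      where
      widen : ∀ {y z} → Star (ArcOff L) y z → Star (ArcOff (L ∖ x)) y z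
      widen = gmap (λ z → z) λ (e , y∉ , z∉) → e , ∉-∖-mono L y∉ , ∉-∖-mono L z∉

      hub : ∀ {z} → z ∉ L ∖ x → Star (ArcOff (L ∖ x)) z x × Star (ArcOff (L ∖ x)) x z
      hub z∉ with ∉-∖⁻ L x z∉
      ... | inj₁ refl = ε , ε
      ... | inj₂ z∉L =
        widen (conn z∉L p∉L) ◅◅ return (p⟶x , ∉-∖-mono L p∉L , ∉-∖-self L) ,
        (x⟶q , ∉-∖-self L , ∉-∖-mono L q∉L) ◅ widen (conn q∉L z∉L)

    module _ {L : List (Fin t)} (d : Detour L) where

      open Detour d

      b∉L∖a∖b : b ∉ L ∖ a ∖ b
      b∉L∖a∖b = ∉-∖-self (L ∖ a)

      a∉L∖a∖b : a ∉ L ∖ a ∖ b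
      a∉L∖a∖b = ∉-∖-mono (L ∖ a) (∉-∖-self L)

      ∉-∖∖-mono : ∀ {z} → z ∉ L → z ∉ L ∖ a ∖ b
      ∉-∖∖-mono = ∉-∖-mono (L ∖ a) ∘ ∉-∖-mono L

      -- Every vertex of S = V ∖ L lies on the triangle b → a → s → b, so any
      -- v ∈ S suffices to connect {a , b} with what is kept of S.
      detour-connected : ∀ {v M} → v ∉ L → v ∉ M → a ∉ M → b ∉ M →
                         (∀ {z} → z ∉ M → z ∉ L ∖ a ∖ b) → ConnectedOff M
      detour-connected {v} {M} v∉L v∉M a∉M b∉M M⊇ = throughHub a hub
        where
        hub : ∀ {z} → z ∉ M → Star (ArcOff M) z a × Star (ArcOff M) a z
        hub z∉M with ∉-∖⁻ (L ∖ a) b (M⊇ z∉M)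
        ... | inj₁ refl = return (b⟶a , b∉M , a∉M) ,
                          (from v∉L , a∉M , v∉M) ◅ return (into v∉L , v∉M , b∉M)
        ... | inj₂ z∉L∖a with ∉-∖⁻ L a z∉L∖a
        ...   | inj₁ refl = ε , ε
        ...   | inj₂ z∉L  = (into z∉L , z∉M , b∉M) ◅ return (b⟶a , b∉M , a∉M) ,
                            return (from z∉L , a∉M , z∉M)

    -- Here S is everything except `w`. Stating this by membership lets `L` contain repetitions.
    connected-ᵛ : ∀ {L w} → ConnectedOff L → (∀ {z} → z ∈ L → z ≡ w) → w ∈ L → Connected (D -ᵛ w)
    connected-ᵛ {L} {w} conn only w∈L x y = restrict (conn (keep x) (keep y)) x y refl refl
      where
      keep : (x : Remaining (Fin t) w) → vertex x ∉ L
      keep (remaining z z≢w) z∈L = ⊥-elim-irr (z≢w (only z∈L))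

      restrict : ∀ {p q} → Star (ArcOff L) p q → ∀ x y → vertex x ≡ p → vertex y ≡ q →
                 Walk (D -ᵛ w) x y
      -- Equal `vertex` fields make `x` and `y` definitionally equal, since `distinct` is
      -- irrelevant.
      restrict ε x y refl refl = ε
      restrict (_◅_ {j = z} (e , _ , z∉L) r) x y refl q =
        e ◅ restrict r (remaining z λ { refl → z∉L w∈L }) y refl q

    -- Growing a strong set around a given vertex

    Noncritical≢ : Fin t → Set
    Noncritical≢ v = ∃ λ w → w ≢ v × Connected (D -ᵛ w)

    -- Invariants: `v` stays in S, `s` is a second vertex of S available for exchange, and `w`
    -- witnesses that `L` is nonempty.
    grow : ∀ {v s w} L → Acc _<_ (length L) → v ∉ L → s ∉ L → s ≢ v → w ∈ L →
           ConnectedOff L → Noncritical≢ v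
    grow {v} {s} {w} L (acc rec) v∉L s∉L s≢v w∈L conn
      with any? (λ z → (z ∈? L) ×-dec ¬? (z ≟ w))
    ... | no none = w , ∈∉⇒≢ w∈L v∉L ,
          connected-ᵛ conn (λ {z} z∈L → decidable-stable (z ≟ w) λ z≢w → none (z , z∈L , z≢w)) w∈L
    ... | yes (w′ , w′∈L , w′≢w) with insertable⊎detour L v∉L w∈L
    ...   | inj₁ (x , ins@(x∈L , _)) with w ≟ x
    ...     | no w≢x =
              grow (L ∖ x) (rec (length-∖ x∈L)) (∉-∖-mono L v∉L) (∉-∖-mono L s∉L) s≢v
                (∈-∖⁺ w∈L w≢x) (insert-connected conn ins)
    -- The inserted vertex is `w` itself, so `w′` takes over as the witness left in `L`.
    ...     | yes refl =
              grow (L ∖ x) (rec (length-∖ x∈L)) (∉-∖-mono L v∉L) (∉-∖-mono L s∉L) s≢v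
                (∈-∖⁺ w′∈L w′≢w) (insert-connected conn ins)
    grow {v} {s} L (acc rec) v∉L s∉L s≢v w∈L conn | yes _ | inj₂ d =
      -- After the exchange `a` is the second vertex of S, and `s` is the witness in `L`.
      grow (s ∷ L ∖ a ∖ b) (rec shorter) v∉M a∉M (∈∉⇒≢ a∈L v∉L) (here refl)
        (detour-connected d v∉L v∉M a∉M b∉M (_∘ there))
      where
      open Detour d

      shorter : length (s ∷ L ∖ a ∖ b) < length L
      shorter = ≤-trans (s≤s (length-∖ (∈-∖⁺ b∈L b≢a))) (length-∖ a∈L)

      ∉-∷ : ∀ {z} → z ≢ s → z ∉ L ∖ a ∖ b → z ∉ s ∷ L ∖ a ∖ b
      ∉-∷ z≢s z∉ (here z≡s) = z≢s z≡s
      ∉-∷ z≢s z∉ (there z∈) = z∉ z∈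

      v∉M : v ∉ s ∷ L ∖ a ∖ b
      v∉M = ∉-∷ (≢-sym s≢v) (∉-∖∖-mono d v∉L)

      a∉M : a ∉ s ∷ L ∖ a ∖ b
      a∉M = ∉-∷ (∈∉⇒≢ a∈L s∉L) (a∉L∖a∖b d)

      b∉M : b ∉ s ∷ L ∖ a ∖ b
      b∉M = ∉-∷ (∈∉⇒≢ b∈L s∉L) (b∉L∖a∖b d)

    -- Growth starts from S = {`v`}, which has no second vertex to exchange. A first detour
    -- therefore adds both `a` and `b`, and `4 ≤ t` leaves a vertex outside.
    noncritical≢ : 4 ≤ t → ∀ v → Noncritical≢ v
    noncritical≢ 4≤t v = start
      where
      L : List (Fin t)
      L = allFin t ∖ v

      v∉L : v ∉ L
      v∉L = ∉-∖-self (allFin t)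

      ∈L : ∀ {z} → z ≢ v → z ∈ L
      ∈L = ∈-∖⁺ (∈-allFin _)

      alone : ConnectedOff L
      alone x∉ y∉ with ∉-∖⁻ (allFin t) v x∉ | ∉-∖⁻ (allFin t) v y∉
      ... | inj₂ x∉all | _          = contradiction (∈-allFin _) x∉all
      ... | inj₁ _     | inj₂ y∉all = contradiction (∈-allFin _) y∉all
      ... | inj₁ refl  | inj₁ refl  = ε

      another : ∀ a b → ∃ λ w → w ≢ v × w ≢ a × w ≢ b
      another a b with fresh (v ∷ a ∷ b ∷ []) 4≤t
      ... | w , w∉ = w , (λ e → w∉ (here e)) , (λ e → w∉ (there (here e))) ,
                     (λ e → w∉ (there (there (here e))))

      start : Noncritical≢ v
      start with insertable⊎detour L v∉L (∈L (proj₁ (proj₂ (another v v))))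
      ... | inj₁ (x , ins@(x∈L , _)) =
            let w , w≢v , w≢x , _ = another x x in
            grow (L ∖ x) (<-wellFounded _) (∉-∖-mono L v∉L) (∉-∖-self L) (∈∉⇒≢ x∈L v∉L)
              (∈-∖⁺ (∈L w≢v) w≢x) (insert-connected alone ins)
      ... | inj₂ d =
            let open Detour d
                w , w≢v , w≢a , w≢b = another a b
            in
            grow (L ∖ a ∖ b) (<-wellFounded _) (∉-∖∖-mono d v∉L) (a∉L∖a∖b d) (∈∉⇒≢ a∈L v∉L)
              (∈-∖⁺ (∈-∖⁺ (∈L w≢v) w≢a) w≢b)
              (detour-connected d v∉L (∉-∖∖-mono d v∉L) (a∉L∖a∖b d) (b∉L∖a∖b d) (λ z∉ → z∉))

-- Lifting walks along a projection

module _ {W U : Set} (G : Digraph W) (E : Digraph U) (π : W → U) (r : U → W)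
         (π∘r : ∀ u → π (r u) ≡ u) (pullback : ∀ {x y} → Arc E (π x) (π y) → Arc G x y) where

  -- A nonempty walk lifts with both ends prescribed: `r` chooses only the inner vertices.
  lift⁺ : ∀ {x y u} → Arc E (π x) u → Walk E u (π y) → Walk G x y
  lift⁺ a ε = return (pullback a)
  lift⁺ {x} {u = u} a (b ◅ w) =
    pullback (subst (Arc E (π x)) (sym (π∘r u)) a)
      ◅ lift⁺ (subst (λ u → Arc E u _) (sym (π∘r u)) b) w

  lift-connected : (∀ {x y} → π x ≡ π y → Walk G x y) → Connected E → Connected G
  lift-connected fibre conn x y = go (conn (π x) (π y)) refl
    where
    go : ∀ {u} → Walk E u (π y) → π x ≡ u → Walk G x y
    go ε       πx≡πy = fibre πx≡πy
    go (a ◅ w) refl  = lift⁺ a w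

  -- A second vertex of `E` forces an arc out of `π x`; continuing from it to `π y` gives a nonempty
  -- walk, which lifts even within a fibre.
  lift-connected-≢ : (∀ u → ∃ λ u′ → u ≢ u′) → Connected E → Connected G
  lift-connected-≢ other conn = lift-connected fibre conn
    where
    fibre : ∀ {x y} → π x ≡ π y → Walk G x y
    fibre {x} {y} _ with other (π x)
    ... | u , πx≢u with conn (π x) u
    ...   | ε     = contradiction refl πx≢u
    ...   | a ◅ _ = lift⁺ a (conn _ (π y))

-- Deleting a vertex from a composition

sum-tabulate≤ : ∀ t (n : Fin t → ℕ) → (∀ i → n i ≤ 1) → sum (tabulate n) ≤ t
sum-tabulate≤ zero    n n≤1 = z≤n
sum-tabulate≤ (suc t) n n≤1 = +-mono-≤ (n≤1 zero) (sum-tabulate≤ t (n ∘ suc) (n≤1 ∘ suc))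

Fin-unique : ∀ {m} → m ≤ 1 → (x y : Fin m) → x ≡ y
Fin-unique (s≤s z≤n) zero zero = refl

module _ {t : ℕ} (T : Digraph (Fin t)) {n : Fin t → ℕ} (1≤n : ∀ i → 1 ≤ n i)
         (H : (i : Fin t) → Digraph (Fin (n i))) where

  Q : Digraph (CompositionVertex n)
  Q = composition T H

  Q-ᵛ-strong : ∀ {v} → Connected (Q -ᵛ v) → Strong (Q -ᵛ v)
  Q-ᵛ-strong = connected⇒strong (≟-remaining (≡-dec _≟_ _≟_)) _

  project : ∀ {x y} → Walk Q x y → Walk T (proj₁ x) (proj₁ y)
  project ε               = ε
  project (within _  ◅ w) = project w
  project (between a ◅ w) = a ◅ project w

  project-connected : Connected Q → Connected T
  project-connected conn i j = project (conn (i , fromℕ< (1≤n i)) (j , fromℕ< (1≤n j)))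

  -- Part `i` still contains `x′`, so the projection onto `T` keeps a section.
  remove-from-large : 2 ≤ t → Connected T → ∀ {i} (x x′ : Fin (n i)) → x′ ≢ x →
                      Strong (Q -ᵛ (i , x))
  remove-from-large 2≤t conn {i} x x′ x′≢x = Q-ᵛ-strong
    (lift-connected-≢ (Q -ᵛ (i , x)) T (proj₁ ∘ vertex) (proj₁ ∘ section) (proj₂ ∘ section)
      between other conn)
    where
    section : ∀ j → Σ (Remaining _ (i , x)) λ z → proj₁ (vertex z) ≡ j
    section j with j ≟ i
    ... | yes refl = remaining (i , x′) (λ { refl → x′≢x refl }) , refl
    ... | no j≢i   = remaining (j , fromℕ< (1≤n j)) (λ e → j≢i (cong proj₁ e)) , refl

    other : ∀ j → ∃ λ k → j ≢ k
    other j with fresh (j ∷ []) 2≤t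
    ... | k , k∉ = k , λ j≡k → k∉ (here (sym j≡k))

  -- Deleting `x` empties part `i`, and the projection onto `T -ᵛ i` has one-point fibres.
  remove-singleton : (∀ i → n i ≤ 1) → ∀ i (x : Fin (n i)) → Connected (T -ᵛ i) →
                     Strong (Q -ᵛ (i , x))
  remove-singleton n≤1 i x conn = Q-ᵛ-strong
    (lift-connected (Q -ᵛ (i , x)) (T -ᵛ i) π r (λ _ → refl) between fibre conn)
    where
    same : {y z : CompositionVertex n} → proj₁ y ≡ proj₁ z → y ≡ z
    same {j , y} {_ , z} refl = cong (j ,_) (Fin-unique (n≤1 j) y z)

    π : Remaining _ (i , x) → Remaining (Fin t) i
    π (remaining z z≢v) = remaining (proj₁ z) λ e → z≢v (same e)

    r : Remaining (Fin t) i → Remaining _ (i , x)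
    r (remaining j j≢i) = remaining (j , fromℕ< (1≤n j)) λ e → j≢i (cong proj₁ e)

    fibre : ∀ {y z} → π y ≡ π z → Walk (Q -ᵛ (i , x)) y z
    fibre {remaining y _} {remaining z _} e with same {y} {z} (cong vertex e)
    ... | refl = ε

theorem2p5 : (t : ℕ) → 2 ≤ t →
    (T : Digraph (Fin t)) → Semicomplete T →
    (n : Fin t → ℕ) → ((i : Fin t) → 1 ≤ n i) →
    (H : (i : Fin t) → Digraph (Fin (n i))) →
    Strong (composition T H) →
    4 ≤ sum (tabulate n) →
    ∃₂ λ (v₁ v₂ : CompositionVertex n) →
    v₁ ≢ v₂ × Strong (composition T H -ᵛ v₁) × Strong (composition T H -ᵛ v₂)
theorem2p5 t 2≤t T semicomplete n 1≤n H strong 4≤∑n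
  with project-connected T 1≤n H (λ x y → proj₁ (strong x y)) | any? (λ i → 2 ≤? n i)
... | conn | yes (i , 2≤nᵢ) with fresh (x₁ ∷ []) 2≤nᵢ
  where
  x₁ : Fin (n i)
  x₁ = fromℕ< (1≤n i)
...   | x₂ , x₂∉ =
  (i , _) , (i , x₂) , (λ { refl → x₂≢x₁ refl }) ,
  remove-from-large T 1≤n H 2≤t conn _ x₂ x₂≢x₁ ,
  remove-from-large T 1≤n H 2≤t conn x₂ _ (≢-sym x₂≢x₁)
  where
  x₂≢x₁ : x₂ ≢ fromℕ< (1≤n i)
  x₂≢x₁ e = x₂∉ (here e)
theorem2p5 t 2≤t T semicomplete n 1≤n H strong 4≤∑n | conn | no none =
  (w₁ , _) , (w₂ , _) , (λ e → w₂≢w₁ (sym (cong proj₁ e))) ,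
  remove-singleton T 1≤n H n≤1 w₁ (fromℕ< (1≤n w₁)) c₁ ,
  remove-singleton T 1≤n H n≤1 w₂ (fromℕ< (1≤n w₂)) c₂
  where
  n≤1 : ∀ i → n i ≤ 1
  n≤1 i = ≤-pred (≰⇒> λ 2≤nᵢ → none (i , 2≤nᵢ))

  other : ∀ v → ∃ λ w → w ≢ v × Connected (T -ᵛ w)
  -- With singleton parts the vertex count is at most `t`, so `4 ≤ t`.
  other = noncritical≢ T semicomplete conn (≤-trans 4≤∑n (sum-tabulate≤ t n n≤1))

  w₁ w₂ : Fin t
  -- The starting vertex is arbitrary; `2≤t`, read as 1 < `t`, supplies one.
  w₁ = proj₁ (other (fromℕ< 2≤t))
  w₂ = proj₁ (other w₁)

  w₂≢w₁ : w₂ ≢ w₁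
  w₂≢w₁ = proj₁ (proj₂ (other w₁))

  c₁ : Connected (T -ᵛ w₁)
  c₁ = proj₂ (proj₂ (other (fromℕ< 2≤t)))

  c₂ : Connected (T -ᵛ w₂)
  c₂ = proj₂ (proj₂ (other w₁))
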